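{- Let $G$ be a plane graph with maximum degree $\Delta\ge 2$. Then $\pi_{fl}(G)\le \lceil \Delta + 4\sqrt{\Delta}+3\rceil$.
   Context: A plane graph is a planar graph with a fixed embedding in the plane. A facial path is a path whose vertices are consecutive vertices on the boundary walk of some face. A $2j$-repetition is a path $v_1\dots v_{2j}$ with $c(v_i)=c(v_{i+j})$ for $1\le i\le j$. A vertex-coloring is facially non-repetitive if no facial path is a repetition. $\pi_{fl}(G)$, the facial Thue choice number, is the minimum $k$ such that for every assignment of lists of size at least $k$ to the vertices, $G$ has a facially non-repetitive coloring with each vertex colored from its list. -}

module Defs where

open import Data.Empty using (⊥-elim)
open import Data.Fin using (Fin; toℕ; _↑ˡ_; _↑ʳ_)
import Data.Fin as Fin
open import Data.List using (List; length; filter; map; allFin; cartesianProduct)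
open import Data.List.Extrema.Nat using (max)
open import Data.List.Membership.Propositional using (_∈_)
open import Data.List.Relation.Unary.Unique.Propositional using (Unique)
open import Data.Nat using (ℕ; zero; suc; _+_; _*_; _≤_; _≤?_; _≟_; z≤n; s≤s)
open import Data.Nat.GeneralisedArithmetic using (iterate)
open import Data.Nat.Properties
  using (≤-trans; ≤-refl; n≤1+n; ≮⇒≥; m≤n+m; *-mono-≤; _<?_)
open import Data.Product using (∃-syntax; _×_; _,_)
open import Function.Bundles using (_⇔_)
open import Function.Definitions using (Injective; Surjective)
open import Level using (0ℓ)
open import Relation.Binary using (Rel; Decidable; Symmetric; Irreflexive)
open import Relation.Binary.Construct.Closure.ReflexiveTransitive using (Star)
open import Relation.Binary.PropositionalEquality using (_≡_)
open import Relation.Nullary using (¬_; yes; no)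
open import Relation.Nullary.Decidable using (_×-dec_)
open import Relation.Unary using (Pred)

IsLeast : Pred ℕ 0ℓ → ℕ → Set
IsLeast P k = P k × (∀ m → P m → k ≤ m)

private
  raise : ℕ → ℕ → ℕ
  raise n r with n ≤? r * r
  ... | yes _ = r
  ... | no  _ = suc r

  raise-isLeast : ∀ n r → IsLeast (λ m → n ≤ m * m) r →
                  IsLeast (λ m → suc n ≤ m * m) (raise (suc n) r)
  raise-isLeast n r (q , least) with suc n ≤? r * r
  ... | yes p = p , λ m s → least m (≤-trans (n≤1+n n) s)
  ... | no ¬p = s≤s (≤-trans q (≤-trans (*-mono-≤ (≤-refl {r}) (n≤1+n r)) (m≤n+m _ r))) , above
    where
    above : ∀ m → suc n ≤ m * m → suc r ≤ m
    above m s with r <? m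
    ... | yes r<m = r<m
    ... | no  r≮m = ⊥-elim (¬p (≤-trans s (*-mono-≤ (≮⇒≥ r≮m) (≮⇒≥ r≮m))))

⌈√_⌉ : ℕ → ℕ
⌈√ zero ⌉  = 0
⌈√ suc n ⌉ = raise (suc n) ⌈√ n ⌉

⌈√⌉-isLeast : ∀ n → IsLeast (λ m → n ≤ m * m) ⌈√ n ⌉
⌈√⌉-isLeast zero    = z≤n , λ _ _ → z≤n
⌈√⌉-isLeast (suc n) = raise-isLeast n ⌈√ n ⌉ (⌈√⌉-isLeast n)

-- ⌈x + 4√x + 3⌉ for natural x: 4√x = √(16x), and integers may be moved out
-- of a ceiling.
⌈_+4√-+3⌉ : ℕ → ℕ
⌈ x +4√-+3⌉ = x + ⌈√ 16 * x ⌉ + 3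

record Graph (n : ℕ) : Set₁ where
  field
    Adj    : Rel (Fin n) 0ℓ
    adj?   : Decidable Adj
    symm   : Symmetric Adj
    irrefl : Irreflexive _≡_ Adj

  degree : Fin n → ℕ
  degree v = length (filter (adj? v) (allFin n))

  maxDegree : ℕ
  maxDegree = max 0 (map degree (allFin n))

  numEdges : ℕ
  numEdges = length (filter (λ (u , v) → u Fin.<? v ×-dec adj? u v)
                            (cartesianProduct (allFin n) (allFin n)))

  numIsolated : ℕ
  numIsolated = length (filter (λ v → degree v ≟ 0) (allFin n))

  record Dart : Set where
    constructor dart
    field
      {tail head} : Fin n
      edge        : Adj tail head

-- A rotation system: `next v` runs through the neighbours of v in a single
-- cycle, namely in their (say, clockwise) order around v. Transitivity forces
-- `next v` to permute the neighbourhood; its values elsewhere are irrelevant.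
record RotationSystem {n : ℕ} (G : Graph n) : Set where
  open Graph G
  field
    next       : Fin n → Fin n → Fin n
    next-adj   : ∀ {v u} → Adj v u → Adj v (next v u)
    next-cycle : ∀ {v u w} → Adj v u → Adj v w → ∃[ k ] iterate (next v) u k ≡ w

  -- Arriving at v from u, the boundary of the face on a fixed side of the
  -- dart (u , v) continues to next v u. The boundary walk is unrolled
  -- periodically: (u , v) recurs after one full turn around the face.
  walk : Fin n → Fin n → ℕ → Fin n
  walk u v zero    = u
  walk u v (suc i) = walk v (next v u) i

  boundaryWalk : Dart → ℕ → Fin n
  boundaryWalk d = walk (Dart.tail d) (Dart.head d)

  SameBoundary : Rel Dart 0ℓ
  SameBoundary d e = ∃[ k ] (boundaryWalk d k ≡ Dart.tail e × boundaryWalk d (suc k) ≡ Dart.head e)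

-- R is an equivalence relation with exactly k classes.
record HasClasses {A : Set} (R : Rel A 0ℓ) (k : ℕ) : Set where
  field
    class      : A → Fin k
    surjective : Surjective _≡_ _≡_ class
    classifies : ∀ x y → class x ≡ class y ⇔ R x y

-- A plane graph, given combinatorially: a finite simple graph, not necessarily
-- connected, with a rotation system of genus 0. An isolated vertex carries no
-- dart but bounds one (trivial) boundary walk. With V − E + W = 2 for each
-- component, where W counts boundary walks, genus 0 means V − E + W = 2C;
-- conversely V − E + W ≤ 2 always holds for a component, so the sum forces
-- equality in each. How distinct components are placed within each other's
-- faces is not recorded: it has no effect on the individual boundary walks.
record PlaneGraph (n : ℕ) : Set₁ where
  field
    graph         : Graph n
    rotation      : RotationSystem graph
  open Graph graph public
  open RotationSystem rotation public
  field
    numBoundaries : ℕ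
    numComponents : ℕ
    boundaries    : HasClasses SameBoundary numBoundaries
    components    : HasClasses (Star Adj) numComponents
    euler         : n + (numBoundaries + numIsolated) ≡ numEdges + 2 * numComponents

module _ {n : ℕ} (G : PlaneGraph n) where
  open PlaneGraph G

  -- Boundary walks are traversed in one direction only; a path is a repetition
  -- iff its reversal is, so this is no restriction below.
  FacialPath : (m : ℕ) → (Fin m → Fin n) → Set
  FacialPath m p = Injective _≡_ _≡_ p × ∃[ d ] (∀ i → p i ≡ boundaryWalk d (toℕ i))

  IsRepetition : (c : Fin n → ℕ) (j : ℕ) → (Fin (j + j) → Fin n) → Set
  IsRepetition c j p = ∀ (i : Fin j) → c (p (i ↑ˡ j)) ≡ c (p (j ↑ʳ i))

  FaciallyNonRepetitive : (Fin n → ℕ) → Set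
  FaciallyNonRepetitive c =
    ∀ j → 1 ≤ j → ∀ p → FacialPath (j + j) p → ¬ IsRepetition c j p

  FaciallyThueChoosable : ℕ → Set
  FaciallyThueChoosable k =
    (L : Fin n → List ℕ) → (∀ v → Unique (L v)) → (∀ v → k ≤ length (L v)) →
    ∃[ c ] ((∀ v → c v ∈ L v) × FaciallyNonRepetitive c)

  IsFacialThueChoiceNumber : ℕ → Set
  IsFacialThueChoiceNumber = IsLeast FaciallyThueChoosable

{-# OPTIONS --safe #-}
module Submission where

-- Rosenfeld's counting argument. Let C(S) be the number of list colourings of
-- a vertex set S without a repetition on a facial path inside S, and let s be
-- ⌈√(16Δ)⌉. By induction on |S|, C(S) ≥ (s/2) C(S ∖ v) for v ∈ S. Indeed, an
-- extension of a colouring of S ∖ v to v that fails repeats on a facial path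
-- with 2j vertices through v; it is recovered from the colouring of S minus the
-- half H containing v, and C(S ∖ H) ≤ (2/s)^(j-1) C(S ∖ v) by induction. At
-- most Δ paths (j = 1) or 2jΔ choices of path and position (j ≥ 2) pass through
-- v, and Δ ≤ s²/16, s ≥ 6 give
--   Δ + Σ_{j ≥ 2} 2jΔ (2/s)^(j-1) ≤ Δ + s/2 + 3,
-- which is what Δ + s + 3 colours leave after reserving s/2.
-- That a least k exists constructively rests on the decidability of
-- k-choosability: only lists over a palette of n k colours need inspection.

open import Defs
open import Data.Bool using (if_then_else_; true; false)
open import Data.Fin using (Fin; zero; suc; toℕ; fromℕ<; _↑ˡ_; _↑ʳ_; punchIn)
import Data.Fin as Fin
open import Data.Fin.Properties
  using (all?; any?; toℕ-fromℕ<; toℕ<n; toℕ-injective; toℕ-↑ˡ; toℕ-↑ʳ; injective⇒≤;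
         punchIn-injective; punchInᵢ≢i)
open import Data.Fin.Subset using (Subset; _⊆_; _-_; ∣_∣; ⊤; _─_)
  renaming (_∈_ to _∈ₛ_; _∉_ to _∉ₛ_)
open import Data.Fin.Subset.Properties
  using (_∈?_; x∈⁅x⁆; p─q⊆p; x∈p∧x≢y⇒x∈p-y; x∈p⇒∣p-x∣<∣p∣; p⊆q⇒∣p∣≤∣q∣; ∈⊤)
open import Data.List
  using (List; []; _∷_; [_]; _++_; length; map; filter; concat; concatMap; applyUpTo; upTo; take;
         allFin; cartesianProduct; cartesianProductWith)
open import Data.List.Extrema.Nat using (xs≤max)
open import Data.List.Membership.Propositional using (_∈_; find; lose)
open import Data.List.Membership.Propositional.Properties
open import Data.List.Properties
  using (length-++; length-map; length-filter; filter-++; length-tabulate; length-take)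
open import Data.List.Relation.Unary.All as All using (All; []; _∷_)
open import Data.List.Relation.Unary.All.Properties using (¬Any⇒All¬)
open import Data.List.Relation.Unary.AllPairs using ([]; _∷_)
open import Data.List.Relation.Unary.Any as Any using (Any; here; there)
open import Data.List.Relation.Unary.Unique.Propositional using (Unique)
import Data.List.Relation.Unary.Unique.Propositional.Properties as Unique
open import Data.Nat
open import Data.List.Relation.Unary.Unique.DecPropositional _≟_ using (unique?)
open import Data.Nat.DivMod using (_/_; m*n/n≡m; m/n*n≤m; /-monoˡ-≤)
open import Data.Nat.GeneralisedArithmetic using (iterate)
open import Data.Nat.Induction using (<-wellFounded)
open import Data.Nat.ListAction using (sum)
open import Data.Nat.Properties hiding (_≟_)
open import Data.Nat.Tactic.RingSolver using (solve-∀)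
open import Data.Product using (∃-syntax; _×_; _,_; proj₁; proj₂; swap; uncurry)
open import Data.Sum using (_⊎_; inj₁; inj₂)
open import Data.Vec using (Vec; []; _∷_; lookup; tabulate; _[_]≔_; here; there)
open import Data.Vec.Properties
  using (lookup∘tabulate; tabulate∘lookup; tabulate-cong; lookup∘update; lookup∘update′; ∷-injective)
open import Function using (_∘_; case_of_)
open import Function.Definitions using (Injective)
open import Induction.WellFounded using (Acc; acc)
open import Relation.Binary.PropositionalEquality
  using (_≡_; _≢_; refl; sym; trans; cong; cong₂; subst; subst₂)
open import Relation.Nullary using (¬_; Dec; yes; no; does; contradiction)
open import Relation.Nullary.Decidable using (map′; _×-dec_; _→-dec_; ¬?; dec-true; dec-false)

-- Finite lists and vectors

module _ {A B : Set} (f : A → B) where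

  -- Pigeonhole, by cutting the image of the head out of `ys`. Injectivity is asked on members of
  -- `xs` only: the map used in `kℓ≤cover` forgets the old colour at `v`.
  unique⇒length≤ : ∀ {xs ys} → Unique xs → (∀ {x} → x ∈ xs → f x ∈ ys) →
                   (∀ {x y} → x ∈ xs → y ∈ xs → f x ≡ f y → x ≡ y) →
                   length xs ≤ length ys
  unique⇒length≤ {[]} _ _ _ = z≤n
  unique⇒length≤ {x ∷ xs} (x∉ ∷ uniq) into inj with ∈-∃++ (into (here refl))
  ... | as , bs , refl = begin
    suc (length xs)              ≤⟨ s≤s (unique⇒length≤ uniq into′ λ p q → inj (there p) (there q)) ⟩
    suc (length (as ++ bs))      ≡⟨ cong suc (length-++ as) ⟩
    suc (length as + length bs)  ≡⟨ +-suc _ _ ⟨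
    length as + suc (length bs)  ≡⟨ length-++ as ⟨
    length (as ++ f x ∷ bs)      ∎
    where
    open ≤-Reasoning
    into′ : ∀ {y} → y ∈ xs → f y ∈ as ++ bs
    into′ y∈ with ∈-++⁻ as (into (there y∈))
    ... | inj₁ p           = ∈-++⁺ˡ p
    ... | inj₂ (here eq)   = contradiction (inj (here refl) (there y∈) (sym eq)) (All.lookup x∉ y∈)
    ... | inj₂ (there p)   = ∈-++⁺ʳ as p

length-concatMap-≤ : ∀ {A B : Set} (f : A → List B) b xs → (∀ {x} → x ∈ xs → length (f x) ≤ b) →
                     length (concatMap f xs) ≤ length xs * b
length-concatMap-≤ f b []       _     = z≤n
length-concatMap-≤ f b (x ∷ xs) bound = begin
  length (f x ++ concatMap f xs)         ≡⟨ length-++ (f x) ⟩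
  length (f x) + length (concatMap f xs) ≤⟨ +-mono-≤ (bound (here refl))
                                              (length-concatMap-≤ f b xs (bound ∘ there)) ⟩
  b + length xs * b                      ∎
  where open ≤-Reasoning

length-concat-applyUpTo-≤ : ∀ {A : Set} (f : ℕ → List A) (g : ℕ → ℕ) N → (∀ j → length (f j) ≤ g j) →
                            length (concat (applyUpTo f N)) ≤ sum (applyUpTo g N)
length-concat-applyUpTo-≤ f g zero    _     = z≤n
length-concat-applyUpTo-≤ f g (suc N) bound = begin
  length (f 0 ++ concat (applyUpTo (f ∘ suc) N))       ≡⟨ length-++ (f 0) ⟩
  length (f 0) + length (concat (applyUpTo (f ∘ suc) N)) ≤⟨ +-mono-≤ (bound 0)
    (length-concat-applyUpTo-≤ (f ∘ suc) (g ∘ suc) N (bound ∘ suc)) ⟩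
  g 0 + sum (applyUpTo (g ∘ suc) N)                    ∎
  where open ≤-Reasoning

module _ {A : Set} where

  choices : ∀ {n} → (Fin n → List A) → List (Vec A n)
  choices {zero}  f = [ [] ]
  choices {suc n} f = cartesianProductWith _∷_ (f zero) (choices (f ∘ suc))

  ∈-choices⁺ : ∀ {n} (f : Fin n → List A) {c} → (∀ v → lookup c v ∈ f v) → c ∈ choices f
  ∈-choices⁺ {zero}  f {[]}    _  = here refl
  ∈-choices⁺ {suc n} f {_ ∷ _} c∈ =
    ∈-cartesianProductWith⁺ _∷_ (c∈ zero) (∈-choices⁺ (f ∘ suc) (c∈ ∘ suc))

  ∈-choices⁻ : ∀ {n} (f : Fin n → List A) {c} → c ∈ choices f → ∀ v → lookup c v ∈ f v
  ∈-choices⁻ {suc n} f c∈ v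
    with ∈-cartesianProductWith⁻ _∷_ (f zero) (choices (f ∘ suc)) c∈
  ∈-choices⁻ {suc n} f c∈ zero    | _ , _ , a∈ , _  , refl = a∈
  ∈-choices⁻ {suc n} f c∈ (suc v) | _ , _ , _  , b∈ , refl = ∈-choices⁻ (f ∘ suc) b∈ v

  choices-unique : ∀ {n} {f : Fin n → List A} → (∀ v → Unique (f v)) → Unique (choices f)
  choices-unique {zero}  _ = [] ∷ []
  choices-unique {suc n} u =
    Unique.cartesianProductWith⁺ _∷_ ∷-injective (u zero) (choices-unique (u ∘ suc))

lookup-ext : ∀ {A : Set} {n} {c d : Vec A n} → (∀ v → lookup c v ≡ lookup d v) → c ≡ d
lookup-ext {c = c} {d} eq =
  trans (sym (tabulate∘lookup c)) (trans (tabulate-cong eq) (tabulate∘lookup d))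

-- Partial list colourings

x∈p─q⇒x∉q : ∀ {n} (p q : Subset n) {x} → x ∈ₛ p ─ q → x ∉ₛ q
x∈p─q⇒x∉q (_ ∷ p) (_ ∷ q) (there x∈) (there x∈q) = x∈p─q⇒x∉q p q x∈ x∈q
x∈p─q⇒x∉q (_ ∷ p) (_ ∷ q) ()         here

module _ {n : ℕ} where

  x∈p-y⇒x≢y : ∀ (p : Subset n) {x y} → x ∈ₛ p - y → x ≢ y
  x∈p-y⇒x≢y p {x} x∈ refl = x∈p─q⇒x∉q p _ x∈ (x∈⁅x⁆ x)

  -- `h zero` is deleted last, so that the final deletion is one application of `Expands` to the set
  -- left by the others.
  removeAll : ∀ {j} → Subset n → (Fin j → Fin n) → Subset n
  removeAll {zero}  S h = S
  removeAll {suc j} S h = removeAll S (h ∘ suc) - h zero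

  removeAll-⊆ : ∀ {j} S (h : Fin j → Fin n) → removeAll S h ⊆ S
  removeAll-⊆ {zero}  S h x∈ = x∈
  removeAll-⊆ {suc j} S h x∈ = removeAll-⊆ S (h ∘ suc) (p─q⊆p _ _ x∈)

  ∈-removeAll⁻ : ∀ {j} S (h : Fin j → Fin n) {x} → x ∈ₛ removeAll S h → ∀ i → h i ≢ x
  ∈-removeAll⁻ {suc j} S h x∈ zero    = x∈p-y⇒x≢y (removeAll S (h ∘ suc)) x∈ ∘ sym
  ∈-removeAll⁻ {suc j} S h x∈ (suc i) = ∈-removeAll⁻ S (h ∘ suc) (p─q⊆p _ _ x∈) i

  ∈-removeAll⁺ : ∀ {j} S (h : Fin j → Fin n) {x} → x ∈ₛ S → (∀ i → h i ≢ x) → x ∈ₛ removeAll S h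
  ∈-removeAll⁺ {zero}  S h x∈ _ = x∈
  ∈-removeAll⁺ {suc j} S h x∈ ≢ =
    x∈p∧x≢y⇒x∈p-y (∈-removeAll⁺ S (h ∘ suc) x∈ (≢ ∘ suc)) (≢ zero ∘ sym)

length-cartesianProduct : ∀ {A B : Set} (xs : List A) (ys : List B) →
                          length (cartesianProduct xs ys) ≡ length xs * length ys
length-cartesianProduct []       ys = refl
length-cartesianProduct (x ∷ xs) ys = trans (length-++ (map (x ,_) ys))
  (cong₂ _+_ (length-map (x ,_) ys) (length-cartesianProduct xs ys))

-- own and twin are the two halves of a path; the path is a repetition
-- when they receive the same colours.
Halves : ℕ → ℕ → Set
Halves n j = (Fin (suc j) → Fin n) × (Fin (suc j) → Fin n)

-- The index `j` is one less than the length of a half: `paths j` lists paths on 2j + 2 vertices,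
-- and only `j < N` is tested.
module Colourings {n : ℕ} (N : ℕ) (paths : ∀ j → List (Halves n j)) (L : Fin n → List ℕ) where

  -- Membership in `S` is required because the junk colours outside `S` would create spurious
  -- repetitions.
  Repeats : ∀ {j} → Subset n → Vec ℕ n → Halves n j → Set
  Repeats S c (own , twin) =
    ∀ i → (own i ∈ₛ S × twin i ∈ₛ S) × lookup c (own i) ≡ lookup c (twin i)

  Valid : Subset n → Vec ℕ n → Set
  Valid S c = ∀ (j : Fin N) → All (λ P → ¬ Repeats S c P) (paths (toℕ j))

  repeats? : ∀ {j} S c (P : Halves n j) → Dec (Repeats S c P)
  repeats? S c (own , twin) =
    all? λ i → (own i ∈? S ×-dec twin i ∈? S) ×-dec (lookup c (own i) ≟ lookup c (twin i))

  valid? : ∀ S c → Dec (Valid S c)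
  valid? S c = all? λ j → All.all? (¬? ∘ repeats? S c) (paths (toℕ j))

  invalid⇒repeats : ∀ {S c} → ¬ Valid S c →
                    ∃[ j ] (j < N × ∃[ P ] (P ∈ paths j × Repeats S c P))
  invalid⇒repeats {S} {c} ¬val with any? (λ (j : Fin N) → Any.any? (repeats? S c) (paths (toℕ j)))
  ... | yes (j , found) = toℕ j , toℕ<n j , find found
  ... | no none = contradiction (λ j → ¬Any⇒All¬ (paths (toℕ j)) λ p → none (j , p)) ¬val

  -- The junk colour 0 outside S makes a colouring of S a unique vector.
  palette : Subset n → Fin n → List ℕ
  palette S v with v ∈? S
  ... | yes _ = L v
  ... | no  _ = [ 0 ]

  palette-∈ : ∀ {S v} → v ∈ₛ S → palette S v ≡ L v
  palette-∈ {S} {v} v∈ with v ∈? S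
  ... | yes _  = refl
  ... | no  v∉ = contradiction v∈ v∉

  palette-∉ : ∀ {S v} → v ∉ₛ S → palette S v ≡ [ 0 ]
  palette-∉ {S} {v} v∉ with v ∈? S
  ... | yes v∈ = contradiction v∈ v∉
  ... | no  _  = refl

  colourings : Subset n → List (Vec ℕ n)
  colourings S = filter (valid? S) (choices (palette S))

  count : Subset n → ℕ
  count S = length (colourings S)

  record ColouringOf (S : Subset n) (c : Vec ℕ n) : Set where
    constructor colouring
    field
      on    : ∀ {v} → v ∈ₛ S → lookup c v ∈ L v
      off   : ∀ {v} → v ∉ₛ S → lookup c v ≡ 0
      valid : Valid S c
  open ColouringOf

  ∈-colourings⁺ : ∀ {S c} → ColouringOf S c → c ∈ colourings S
  ∈-colourings⁺ {S} {c} (colouring on off valid) =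
    ∈-filter⁺ (valid? S) (∈-choices⁺ (palette S) inPalette) valid
    where
    inPalette : ∀ v → lookup c v ∈ palette S v
    inPalette v with v ∈? S
    ... | yes v∈ = on v∈
    ... | no  v∉ = here (off v∉)

  ∈-colourings⁻ : ∀ {S c} → c ∈ colourings S → ColouringOf S c
  ∈-colourings⁻ {S} {c} c∈ with ∈-filter⁻ (valid? S) {xs = choices (palette S)} c∈
  ... | c∈′ , valid = colouring
    (λ {v} v∈ → subst (lookup c v ∈_) (palette-∈ v∈) (∈-choices⁻ (palette S) c∈′ v))
    (λ {v} v∉ → case subst (lookup c v ∈_) (palette-∉ v∉) (∈-choices⁻ (palette S) c∈′ v) of
                  λ { (here eq) → eq })
    valid

  colourings-unique : (∀ v → Unique (L v)) → ∀ S → Unique (colourings S)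
  colourings-unique uniq S = Unique.filter⁺ (valid? S) (choices-unique uniq′)
    where
    uniq′ : ∀ v → Unique (palette S v)
    uniq′ v with v ∈? S
    ... | yes _ = uniq v
    ... | no  _ = [] ∷ []

  valid-⊆ : ∀ {S T c d} → T ⊆ S → (∀ {v} → v ∈ₛ T → lookup d v ≡ lookup c v) → Valid S c → Valid T d
  valid-⊆ {S} {T} {c} {d} T⊆S agree valid j = All.map (λ {P} ¬rep rep → ¬rep (repeats-⊇ P rep)) (valid j)
    where
    repeats-⊇ : ∀ {j} (P : Halves n j) → Repeats T d P → Repeats S c P
    repeats-⊇ P rep i with rep i
    ... | (own∈ , twin∈) , eq =
      (T⊆S own∈ , T⊆S twin∈) , trans (sym (agree own∈)) (trans eq (agree twin∈))

  restrict : Subset n → Vec ℕ n → Vec ℕ n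
  restrict T c = tabulate λ v → if does (v ∈? T) then lookup c v else 0

  restrict-∈ : ∀ {T v} c → v ∈ₛ T → lookup (restrict T c) v ≡ lookup c v
  restrict-∈ {T} {v} c v∈ = trans (lookup∘tabulate _ v)
    (cong (if_then lookup c v else 0) (dec-true (v ∈? T) v∈))

  restrict-∉ : ∀ {T v} c → v ∉ₛ T → lookup (restrict T c) v ≡ 0
  restrict-∉ {T} {v} c v∉ = trans (lookup∘tabulate _ v)
    (cong (if_then lookup c v else 0) (dec-false (v ∈? T) v∉))

  restrict-colouring : ∀ {S T c} → T ⊆ S → ColouringOf S c → ColouringOf T (restrict T c)
  restrict-colouring {T = T} {c} T⊆S col = colouring
    (λ v∈ → subst (_∈ L _) (sym (restrict-∈ c v∈)) (on col (T⊆S v∈)))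
    (restrict-∉ c)
    (valid-⊆ {c = c} {restrict T c} T⊆S (restrict-∈ c) (valid col))

  twinColour : ∀ {j} → (Fin (suc j) → Fin n) → Vec ℕ n → ∀ {own : Fin (suc j) → Fin n} v →
               Dec (∃[ i ] own i ≡ v) → ℕ
  twinColour twin c v (yes (i , _)) = lookup c (twin i)
  twinColour twin c v (no _)        = lookup c v

  -- Recovers a repetitively coloured path from its restriction to one half.
  copyTwin : ∀ {j} → Halves n j → Vec ℕ n → Vec ℕ n
  copyTwin (own , twin) c = tabulate λ v → twinColour twin c v (any? λ i → own i Fin.≟ v)

  copyTwin-≡ : ∀ {j} {own twin : Fin (suc j) → Fin n} {c d} →
               (∀ i → lookup c (twin i) ≡ lookup d (own i)) →
               (∀ v → (∀ i → own i ≢ v) → lookup c v ≡ lookup d v) →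
               copyTwin (own , twin) c ≡ d
  copyTwin-≡ {own = own} {twin} {c} {d} onOwn off = lookup-ext λ v →
    trans (lookup∘tabulate _ v) (eq v (any? λ i → own i Fin.≟ v))
    where
    eq : ∀ v (q : Dec (∃[ i ] own i ≡ v)) → twinColour twin c v q ≡ lookup d v
    eq v (yes (i , refl)) = onOwn i
    eq v (no  ∄)          = off v λ i e → ∄ (i , e)

-- The counting step

-- s / 2 is the factor by which each vertex multiplies the number of colourings.
module Counting {n : ℕ} (N : ℕ) (paths : ∀ j → List (Halves n j)) (L : Fin n → List ℕ)
  (L-unique : ∀ v → Unique (L v)) (k : ℕ) (k≤ : ∀ v → k ≤ length (L v))
  (simple : ∀ {j own twin} → (own , twin) ∈ paths j →
            Injective _≡_ _≡_ own × (∀ i i′ → own i ≢ twin i′))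
  (swapped : ∀ {j own twin} → (own , twin) ∈ paths j → (twin , own) ∈ paths j)
  (D : ℕ → ℕ)
  (through : ∀ j v a → length (filter (λ P → proj₁ P a Fin.≟ v) (paths j)) ≤ D j)
  (s : ℕ) .{{_ : NonZero s}}
  -- `ℓ` stands for the number of colourings of S minus v, and `M j` for a bound on that number once
  -- the other `j` vertices of a half are deleted too. The factor `suc j` counts the positions of v
  -- in its half; doubling clears the denominator of s/2.
  (budget : ∀ ℓ (M : ℕ → ℕ) → (∀ j → s ^ j * M j ≤ 2 ^ j * ℓ) →
            2 * sum (applyUpTo (λ j → suc j * (D j * M j)) N) + s * ℓ ≤ 2 * (k * ℓ))
  where

  open Colourings N paths L
  open ColouringOf

  Expands : Subset n → Set
  Expands S = ∀ {v} → v ∈ₛ S → s * count (S - v) ≤ 2 * count S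

  -- One use of the induction hypothesis per vertex, each costing a factor 2/s. Injectivity of `h`
  -- ensures that a vertex is still present when its turn comes.
  removeAll-count : ∀ {j} {S} (h : Fin j → Fin n) → (∀ {T} → T ⊆ S → Expands T) →
                    Injective _≡_ _≡_ h → (∀ i → h i ∈ₛ S) →
                    s ^ j * count (removeAll S h) ≤ 2 ^ j * count S
  removeAll-count {zero}  _ _ _ _ = ≤-refl
  removeAll-count {suc j} {S} h expands h-inj h∈ = begin
    s * s ^ j * count (T - h zero)     ≡⟨ lemma₁ s (s ^ j) (count (T - h zero)) ⟩
    s ^ j * (s * count (T - h zero))   ≤⟨ *-monoʳ-≤ (s ^ j) (expands (removeAll-⊆ S h′) h₀∈T) ⟩
    s ^ j * (2 * count T)              ≡⟨ lemma₁ 2 (s ^ j) (count T) ⟨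
    2 * s ^ j * count T                ≡⟨ *-assoc 2 (s ^ j) (count T) ⟩
    2 * (s ^ j * count T)              ≤⟨ *-monoʳ-≤ 2 (removeAll-count h′ expands
                                            (λ eq → Data.Fin.Properties.suc-injective (h-inj eq)) (h∈ ∘ suc)) ⟩
    2 * (2 ^ j * count S)              ≡⟨ *-assoc 2 (2 ^ j) (count S) ⟨
    2 ^ suc j * count S                ∎
    where
    open ≤-Reasoning
    h′ = h ∘ suc
    T = removeAll S h′
    lemma₁ : ∀ a b c → a * b * c ≡ b * (a * c)
    lemma₁ = solve-∀
    h₀∈T : h zero ∈ₛ T
    h₀∈T = ∈-removeAll⁺ S h′ (h∈ zero) λ i eq → case h-inj eq of λ ()

  module Step {S : Subset n} {v : Fin n} (v∈S : v ∈ₛ S)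
              (expands : ∀ {T} → T ⊆ S - v → Expands T) where

    S₀ : Subset n
    S₀ = S - v

    ℓ : ℕ
    ℓ = count S₀

    -- ⌊(2 / s)^j ℓ⌋
    M : ℕ → ℕ
    M j = _/_ (2 ^ j * ℓ) (s ^ j) {{m^n≢0 s j}}

    M-bound : ∀ j → s ^ j * M j ≤ 2 ^ j * ℓ
    M-bound j = subst (_≤ 2 ^ j * ℓ) (*-comm (M j) (s ^ j)) (m/n*n≤m (2 ^ j * ℓ) (s ^ j) {{m^n≢0 s j}})

    -- Counts are integers, so a count at most (2/s)^j ℓ is at most the floor.
    M-max : ∀ {j m} → s ^ j * m ≤ 2 ^ j * ℓ → m ≤ M j
    M-max {j} {m} le = subst (_≤ M j) (m*n/n≡m m (s ^ j) {{m^n≢0 s j}})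
      (/-monoˡ-≤ (s ^ j) {{m^n≢0 s j}} (subst (_≤ 2 ^ j * ℓ) (*-comm (s ^ j) m) le))

    -- The vertex at position `a` will be `v`, already absent from `S₀`; hence a half of j + 1
    -- vertices costs only j deletions.
    others : ∀ {j} → (Fin (suc j) → Fin n) → Fin (suc j) → Fin j → Fin n
    others own a = own ∘ punchIn a

    inside? : ∀ {j} (P : Halves n j) → Dec (∀ i → proj₁ P i ∈ₛ S)
    inside? (own , _) = all? λ i → own i ∈? S

    -- Halves leaving `S` are dropped, since `removeAll-count` needs the deleted vertices to be
    -- present.
    pathsAt : ∀ j → Fin (suc j) → List (Halves n j)
    pathsAt j a = filter inside? (filter (λ P → proj₁ P a Fin.≟ v) (paths j))

    recoloured : ∀ {j} → Fin (suc j) → Halves n j → List (Vec ℕ n)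
    recoloured a P@(own , _) = map (copyTwin P) (colourings (removeAll S₀ (others own a)))

    bad : ℕ → List (Vec ℕ n)
    bad j = concatMap (λ a → concatMap (recoloured a) (pathsAt j a)) (allFin (suc j))

    length-recoloured : ∀ {j a P} → P ∈ pathsAt j a → length (recoloured a P) ≤ M j
    length-recoloured {j} {a} {P@(own , _)} P∈
      with ∈-filter⁻ inside? {xs = filter (λ P → proj₁ P a Fin.≟ v) (paths j)} P∈
    ... | P∈′ , own∈S with ∈-filter⁻ (λ P → proj₁ P a Fin.≟ v) {xs = paths j} P∈′
    ... | P∈paths , refl = subst (_≤ M j) (sym (length-map (copyTwin P) (colourings (removeAll S₀ (others own a)))))
      (M-max {j} (removeAll-count (others own a) expands
        (λ eq → punchIn-injective a _ _ (own-inj eq))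
        λ i → x∈p∧x≢y⇒x∈p-y (own∈S _) (punchInᵢ≢i a i ∘ own-inj)))
      where
      own-inj = proj₁ (simple P∈paths)

    length-bad : ∀ j → length (bad j) ≤ suc j * (D j * M j)
    length-bad j = subst (λ m → length (bad j) ≤ m * (D j * M j)) (length-tabulate {n = suc j} (λ i → i))
      (length-concatMap-≤ (λ a → concatMap (recoloured a) (pathsAt j a)) (D j * M j) (allFin (suc j)) λ {a} _ → ≤-trans
        (length-concatMap-≤ (recoloured a) (M j) (pathsAt j a) (length-recoloured {j} {a}))
        (*-monoˡ-≤ (M j) (≤-trans (length-filter inside? (filter (λ P → proj₁ P a Fin.≟ v) (paths j))) (through j v a))))

    -- Overcounting is harmless: a colouring may be listed several times, as only an upper bound for
    -- the failing extensions is wanted.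
    cover : List (Vec ℕ n)
    cover = colourings S ++ concat (applyUpTo bad N)

    module _ {c : Vec ℕ n} (col : ColouringOf S₀ c) {x : ℕ} (x∈ : x ∈ L v) where

      c′ : Vec ℕ n
      c′ = c [ v ]≔ x

      c′≡c : ∀ {w} → w ≢ v → lookup c′ w ≡ lookup c w
      c′≡c w≢v = lookup∘update′ w≢v c x

      c′-on : ∀ {w} → w ∈ₛ S → lookup c′ w ∈ L w
      c′-on {w} w∈ with w Fin.≟ v
      ... | yes refl = subst (_∈ L v) (sym (lookup∘update v c x)) x∈
      ... | no  w≢v  = subst (_∈ L w) (sym (c′≡c w≢v)) (on col (x∈p∧x≢y⇒x∈p-y w∈ w≢v))

      c-off : ∀ {w} → w ∉ₛ S → lookup c w ≡ 0
      c-off w∉ = off col (w∉ ∘ p─q⊆p _ _)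

      c′-off : ∀ {w} → w ∉ₛ S → lookup c′ w ≡ 0
      c′-off w∉ = trans (c′≡c λ { refl → w∉ v∈S }) (c-off w∉)

      -- The twin half avoids both `v` and the own half, so its colours survive the restriction to
      -- `T`. Copying them onto the own half, `v` included, restores `c′`.
      own-repeats : ∀ {j own twin} → j < N → (own , twin) ∈ paths j → Repeats S c′ (own , twin) →
                    ∀ a → own a ≡ v → c′ ∈ concat (applyUpTo bad N)
      own-repeats {j} {own} {twin} j<N P∈ rep a refl = ∈-concat⁺′ c′∈bad (∈-applyUpTo⁺ bad j<N)
        where
        T = removeAll S₀ (others own a)

        disjoint = proj₂ (simple P∈)

        twin∈T : ∀ i → twin i ∈ₛ T
        twin∈T i = ∈-removeAll⁺ S₀ (others own a)
          (x∈p∧x≢y⇒x∈p-y (proj₂ (proj₁ (rep i))) (disjoint a i ∘ sym)) λ i′ → disjoint _ i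

        c≡c′ : copyTwin (own , twin) (restrict T c) ≡ c′
        c≡c′ = copyTwin-≡
          (λ i → trans (restrict-∈ c (twin∈T i))
            (trans (sym (c′≡c (disjoint a i ∘ sym))) (sym (proj₂ (rep i)))))
          λ w w∉own → trans (kept w w∉own) (sym (c′≡c (w∉own a ∘ sym)))
          where
          kept : ∀ w → (∀ i → own i ≢ w) → lookup (restrict T c) w ≡ lookup c w
          -- Inside `S` such a vertex belongs to `T`; outside `S` both vectors carry the junk colour
          -- 0.
          kept w w∉own with w ∈? S
          ... | yes w∈ = restrict-∈ c (∈-removeAll⁺ S₀ (others own a)
            (x∈p∧x≢y⇒x∈p-y w∈ (w∉own a ∘ sym)) λ i → w∉own _)
          ... | no  w∉ = trans (restrict-∉ c (w∉ ∘ p─q⊆p _ _ ∘ removeAll-⊆ S₀ (others own a)))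
            (sym (c-off w∉))

        c′∈recoloured : c′ ∈ recoloured a (own , twin)
        c′∈recoloured = subst (_∈ recoloured a (own , twin)) c≡c′
          (∈-map⁺ _ (∈-colourings⁺ (restrict-colouring (removeAll-⊆ S₀ (others own a)) col)))

        P∈pathsAt : (own , twin) ∈ pathsAt j a
        P∈pathsAt = ∈-filter⁺ inside? (∈-filter⁺ (λ P → proj₁ P a Fin.≟ v) P∈ refl)
          λ i → proj₁ (proj₁ (rep i))

        c′∈bad : c′ ∈ bad j
        c′∈bad = ∈-concatMap⁺ (λ a → concatMap (recoloured a) (pathsAt j a))
          (lose (∈-allFin a) (∈-concatMap⁺ (recoloured a) (lose P∈pathsAt c′∈recoloured)))

      -- A repetition of `c′` passes through `v`, since `c` is valid on `S₀`. If `v` lies in the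
      -- twin half, the halves are exchanged, which is why `paths` is closed under swapping.
      c′∈cover : c′ ∈ cover
      c′∈cover with valid? S c′
      ... | yes val = ∈-++⁺ˡ (∈-colourings⁺ (colouring c′-on c′-off val))
      ... | no ¬val with invalid⇒repeats {c = c′} ¬val
      ... | j , j<N , (own , twin) , P∈ , rep
        with any? (λ i → own i Fin.≟ v) | any? (λ i → twin i Fin.≟ v)
      ... | yes (a , eq) | _ = ∈-++⁺ʳ (colourings S) (own-repeats j<N P∈ rep a eq)
      ... | no _ | yes (a , eq) = ∈-++⁺ʳ (colourings S) (own-repeats j<N (swapped P∈)
              (λ i → swap (proj₁ (rep i)) , sym (proj₂ (rep i))) a eq)
      ... | no ∌own | no ∌twin = contradiction
              (λ i → let own≢ = λ eq → ∌own (i , eq) ; twin≢ = λ eq → ∌twin (i , eq) in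
                ( x∈p∧x≢y⇒x∈p-y (proj₁ (proj₁ (rep i))) own≢
                , x∈p∧x≢y⇒x∈p-y (proj₂ (proj₁ (rep i))) twin≢)
                , trans (sym (c′≡c own≢)) (trans (proj₂ (rep i)) (c′≡c twin≢)))
              (All.lookup (subst (λ j → All (λ P → ¬ Repeats S₀ c P) (paths j)) (toℕ-fromℕ< j<N)
                (valid col (fromℕ< j<N))) P∈)

    kℓ≤cover : k * ℓ ≤ length cover
    kℓ≤cover = begin
      k * ℓ                                             ≤⟨ *-monoˡ-≤ ℓ (k≤ v) ⟩
      length (L v) * ℓ                                  ≡⟨ *-comm (length (L v)) ℓ ⟩
      ℓ * length (L v)                                  ≡⟨ length-cartesianProduct (colourings S₀) (L v) ⟨
      length (cartesianProduct (colourings S₀) (L v))   ≤⟨ unique⇒length≤ (λ (c , x) → c [ v ]≔ x)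
        (Unique.cartesianProduct⁺ (colourings-unique L-unique S₀) (L-unique v)) into inj ⟩
      length cover                                      ∎
      where
      open ≤-Reasoning
      member : ∀ {c x} → (c , x) ∈ cartesianProduct (colourings S₀) (L v) → ColouringOf S₀ c × x ∈ L v
      member p with ∈-cartesianProduct⁻ (colourings S₀) (L v) p
      ... | c∈ , x∈ = ∈-colourings⁻ c∈ , x∈
      into : ∀ {cx} → cx ∈ cartesianProduct (colourings S₀) (L v) → proj₁ cx [ v ]≔ proj₂ cx ∈ cover
      into p = c′∈cover (proj₁ (member p)) (proj₂ (member p))
      inj : ∀ {cx dy} → cx ∈ cartesianProduct (colourings S₀) (L v) →
            dy ∈ cartesianProduct (colourings S₀) (L v) →
            proj₁ cx [ v ]≔ proj₂ cx ≡ proj₁ dy [ v ]≔ proj₂ dy → cx ≡ dy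
      inj {c , x} {d , y} p q eq = cong₂ _,_ (lookup-ext agree)
        (trans (sym (lookup∘update v c x)) (trans (cong (λ e → lookup e v) eq) (lookup∘update v d y)))
        where
        agree : ∀ w → lookup c w ≡ lookup d w
        agree w with w Fin.≟ v
        -- `v` lies outside `S₀`, so both colourings have the junk colour 0 there and overwriting it
        -- loses nothing.
        ... | yes refl = trans (off (proj₁ (member p)) λ v∈ → x∈p-y⇒x≢y S v∈ refl)
                         (sym (off (proj₁ (member q)) λ v∈ → x∈p-y⇒x≢y S v∈ refl))
        ... | no  w≢v  = trans (sym (lookup∘update′ w≢v c x))
                         (trans (cong (λ e → lookup e w) eq) (lookup∘update′ w≢v d y))

    -- Instead of subtracting the failing extensions from `k * ℓ`, twice that number is added to
    -- both sides and cancelled.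
    step : s * ℓ ≤ 2 * count S
    step = +-cancelˡ-≤ (2 * (k * ℓ)) _ _ (begin
      2 * (k * ℓ) + s * ℓ          ≤⟨ +-monoˡ-≤ (s * ℓ) (*-monoʳ-≤ 2 kℓ≤cover) ⟩
      2 * length cover + s * ℓ     ≡⟨ cong (λ m → 2 * m + s * ℓ) (length-++ (colourings S)) ⟩
      2 * (count S + length (concat (applyUpTo bad N))) + s * ℓ
                                   ≤⟨ +-monoˡ-≤ (s * ℓ) (*-monoʳ-≤ 2 (+-monoʳ-≤ (count S)
                                        (length-concat-applyUpTo-≤ bad (λ j → suc j * (D j * M j)) N length-bad))) ⟩
      2 * (count S + total) + s * ℓ   ≡⟨ lemma₂ (count S) total (s * ℓ) ⟩
      (2 * total + s * ℓ) + 2 * count S   ≤⟨ +-monoˡ-≤ (2 * count S) (budget ℓ M M-bound) ⟩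
      2 * (k * ℓ) + 2 * count S    ∎)
      where
      open ≤-Reasoning
      total = sum (applyUpTo (λ j → suc j * (D j * M j)) N)
      lemma₂ : ∀ a b c → 2 * (a + b) + c ≡ (2 * b + c) + 2 * a
      lemma₂ = solve-∀

  expands : ∀ S → Expands S
  expands S = go S (<-wellFounded ∣ S ∣)
    where
    go : ∀ S → Acc _<_ ∣ S ∣ → Expands S
    go S (acc rs) v∈S = Step.step v∈S λ {T} T⊆ →
      go T (rs (≤-<-trans (p⊆q⇒∣p∣≤∣q∣ T⊆) (x∈p⇒∣p-x∣<∣p∣ v∈S)))

  count-positive : ∀ S → 1 ≤ count S
  count-positive S = go S (<-wellFounded ∣ S ∣)
    where
    go : ∀ S → Acc _<_ ∣ S ∣ → 1 ≤ count S
    go S (acc rs) with any? (_∈? S)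
    ... | yes (v , v∈S) = *-cancelˡ-< 2 0 (count S) (≤-trans
      (*-mono-≤ (>-nonZero⁻¹ s) (go (S - v) (rs (x∈p⇒∣p-x∣<∣p∣ v∈S)))) (expands S v∈S))
    -- The all-zero vector colours the empty set; every half has at least one vertex, so no path
    -- lies inside.
    ... | no S-empty = ∈-length (∈-colourings⁺ {S} {tabulate λ _ → 0} (colouring
      (λ v∈ → contradiction (_ , v∈) S-empty)
      (λ {v} _ → lookup∘tabulate (λ _ → 0) v)
      λ j → All.tabulate λ _ rep → S-empty (_ , proj₁ (proj₁ (rep zero)))))

  colourable : ∃[ c ] ((∀ v → lookup c v ∈ L v) × Valid ⊤ c)
  colourable with colourings ⊤ in eq | count-positive ⊤
  ... | c ∷ _ | _ = c , (λ v → on col ∈⊤) , valid col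
    where
    col : ColouringOf ⊤ c
    col = ∈-colourings⁻ (subst (c ∈_) (sym eq) (here refl))

-- The numerical estimate

-- Σ_{i ≥ 0} (m + i) / 3^i = (6m + 3) / 4.
geometric : ∀ N m p ℓ (t : ℕ → ℕ) → (∀ i → p * 3 ^ i * t i ≤ (m + i) * ℓ) →
            4 * p * sum (applyUpTo t N) ≤ (6 * m + 3) * ℓ
geometric zero    m p ℓ t bound = subst (_≤ (6 * m + 3) * ℓ) (sym (*-zeroʳ (4 * p))) z≤n
geometric (suc N) m p ℓ t bound = *-cancelˡ-≤ 3 (begin
  3 * (4 * p * (t 0 + rest))                  ≡⟨ lemma₁ p (t 0) rest ⟩
  -- The tail is the same sum with `suc m` for `m` and `3 * p` for `p`, and 12m + 6(m + 1) + 3 =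
  -- 3(6m + 3).
  12 * (p * 1 * t 0) + 4 * (3 * p) * rest     ≤⟨ +-mono-≤ (*-monoʳ-≤ 12 (bound 0))
                                                   (geometric N (suc m) (3 * p) ℓ (t ∘ suc) bound′) ⟩
  12 * ((m + 0) * ℓ) + (6 * suc m + 3) * ℓ    ≡⟨ lemma₂ m ℓ ⟩
  3 * ((6 * m + 3) * ℓ)                       ∎)
  where
  open ≤-Reasoning
  rest = sum (applyUpTo (t ∘ suc) N)
  lemma₁ : ∀ p t r → 3 * (4 * p * (t + r)) ≡ 12 * (p * 1 * t) + 4 * (3 * p) * r
  lemma₁ = solve-∀
  lemma₂ : ∀ m ℓ → 12 * ((m + 0) * ℓ) + (6 * suc m + 3) * ℓ ≡ 3 * ((6 * m + 3) * ℓ)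
  lemma₂ = solve-∀
  lemma₃ : ∀ p q t → p * (3 * q) * t ≡ 3 * p * q * t
  lemma₃ = solve-∀
  bound′ : ∀ i → 3 * p * 3 ^ i * t (suc i) ≤ (suc m + i) * ℓ
  bound′ i = subst₂ _≤_ (lemma₃ p (3 ^ i) (t (suc i))) (cong (_* ℓ) (+-suc m i)) (bound (suc i))

^-distribʳ-* : ∀ a b i → (a * b) ^ i ≡ a ^ i * b ^ i
^-distribʳ-* a b zero    = refl
^-distribʳ-* a b (suc i) = trans (cong (a * b *_) (^-distribʳ-* a b i)) (lemma a b (a ^ i) (b ^ i))
  where
  lemma : ∀ a b p q → a * b * (p * q) ≡ a * p * (b * q)
  lemma = solve-∀

-- Bounds the listed paths with a given vertex at a given position of their own half: Δ for edges,
-- and Δ for each of the two choices of own half on longer paths.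
multiplicity : ℕ → ℕ → ℕ
multiplicity Δ zero    = Δ
multiplicity Δ (suc _) = Δ + Δ

module _ {Δ s : ℕ} (16Δ≤s² : 16 * Δ ≤ s * s) (6≤s : 6 ≤ s) where

  edge-term : ∀ {ℓ m} → 1 * m ≤ 1 * ℓ → 2 * (1 * (Δ * m)) ≤ 2 * (Δ * ℓ)
  edge-term {ℓ} {m} le = *-monoʳ-≤ 2 (subst (_≤ Δ * ℓ) (sym (*-identityˡ (Δ * m)))
    (*-monoʳ-≤ Δ (subst₂ _≤_ (*-identityˡ m) (*-identityˡ ℓ) le)))

  -- From 16Δ ≤ s² and m ≤ 2ℓ/s. The paths on four vertices thus consume half of the summand s in
  -- the number of colours; the other half is the reserve s/2.
  four-term : ∀ {ℓ m} → s * 1 * m ≤ 2 * 1 * ℓ → 2 * (2 * ((Δ + Δ) * m)) ≤ s * ℓ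
  four-term {ℓ} {m} le = *-cancelˡ-≤ 2 (begin
    2 * (2 * (2 * ((Δ + Δ) * m)))  ≡⟨ lemma₁ Δ m ⟩
    16 * Δ * m                     ≤⟨ *-monoˡ-≤ m 16Δ≤s² ⟩
    s * s * m                      ≡⟨ lemma₂ s m ⟩
    s * (s * 1 * m)                ≤⟨ *-monoʳ-≤ s le ⟩
    s * (2 * 1 * ℓ)                ≡⟨ lemma₃ s ℓ ⟩
    2 * (s * ℓ)                    ∎)
    where
    open ≤-Reasoning
    lemma₁ : ∀ Δ m → 2 * (2 * (2 * ((Δ + Δ) * m))) ≡ 16 * Δ * m
    lemma₁ = solve-∀
    lemma₂ : ∀ s m → s * s * m ≡ s * (s * 1 * m)
    lemma₂ = solve-∀
    lemma₃ : ∀ s ℓ → s * (2 * 1 * ℓ) ≡ 2 * (s * ℓ)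
    lemma₃ = solve-∀

  -- Of the factor (2/s)^(2 + i), the part 4/s² absorbs 4Δ because 16Δ ≤ s², and (2/s)^i absorbs 3^i
  -- because s ≥ 6.
  long-term : ∀ {ℓ m} i → s ^ (2 + i) * m ≤ 2 ^ (2 + i) * ℓ → 4 * Δ * (3 ^ i * m) ≤ ℓ
  long-term {ℓ} {m} i le = *-cancelˡ-≤ (2 ^ (2 + i)) {{m^n≢0 2 (2 + i)}} (begin
    2 ^ (2 + i) * (4 * Δ * (3 ^ i * m))  ≡⟨ lemma₁ (2 ^ i) (3 ^ i) Δ m ⟩
    16 * Δ * (2 ^ i * 3 ^ i * m)         ≡⟨ cong (λ q → 16 * Δ * (q * m)) (^-distribʳ-* 2 3 i) ⟨
    16 * Δ * (6 ^ i * m)                 ≤⟨ *-mono-≤ 16Δ≤s² (*-monoˡ-≤ m (^-monoˡ-≤ i 6≤s)) ⟩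
    s * s * (s ^ i * m)                  ≡⟨ lemma₂ s (s ^ i) m ⟩
    s ^ (2 + i) * m                      ≤⟨ le ⟩
    2 ^ (2 + i) * ℓ                      ∎)
    where
    open ≤-Reasoning
    lemma₁ : ∀ p q Δ m → 2 * (2 * p) * (4 * Δ * (q * m)) ≡ 16 * Δ * (p * q * m)
    lemma₁ = solve-∀
    lemma₂ : ∀ s p m → s * s * (p * m) ≡ s * (s * p) * m
    lemma₂ = solve-∀

  -- Edges, four-vertex paths and longer paths cost at most Δℓ, sℓ/2 and 3ℓ, and sℓ/2 is reserved.
  -- The number of terms is `2 + N` so that the first two split off by computation.
  budget : ∀ N ℓ (M : ℕ → ℕ) → (∀ j → s ^ j * M j ≤ 2 ^ j * ℓ) →
           2 * sum (applyUpTo (λ j → suc j * (multiplicity Δ j * M j)) (2 + N)) + s * ℓ ≤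
           2 * ((Δ + s + 3) * ℓ)
  budget N ℓ M bound = begin
    2 * (a + (b + c)) + s * ℓ                    ≡⟨ lemma₁ a b c (s * ℓ) ⟩
    2 * a + (2 * b + 2 * c) + s * ℓ              ≤⟨ +-monoˡ-≤ (s * ℓ) (+-mono-≤ (edge-term (bound 0))
                                                      (+-mono-≤ (four-term (bound 1)) tail)) ⟩
    2 * (Δ * ℓ) + (s * ℓ + 6 * ℓ) + s * ℓ        ≡⟨ lemma₂ Δ s ℓ ⟩
    2 * ((Δ + s + 3) * ℓ)                        ∎
    where
    open ≤-Reasoning
    t : ℕ → ℕ
    t i = (3 + i) * ((Δ + Δ) * M (2 + i))
    a = 1 * (Δ * M 0)
    b = 2 * ((Δ + Δ) * M 1)
    c = sum (applyUpTo t N)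
    lemma₁ : ∀ a b c d → 2 * (a + (b + c)) + d ≡ 2 * a + (2 * b + 2 * c) + d
    lemma₁ = solve-∀
    lemma₂ : ∀ Δ s ℓ → 2 * (Δ * ℓ) + (s * ℓ + 6 * ℓ) + s * ℓ ≡ 2 * ((Δ + s + 3) * ℓ)
    lemma₂ = solve-∀
    lemma₃ : ∀ q i Δ m → 2 * q * ((3 + i) * ((Δ + Δ) * m)) ≡ (3 + i) * (4 * Δ * (q * m))
    lemma₃ = solve-∀
    lemma₄ : ∀ ℓ → 24 * ℓ ≡ 4 * (6 * ℓ)
    lemma₄ = solve-∀
    tail : 2 * c ≤ 6 * ℓ
    tail = *-cancelˡ-≤ 4 (begin
      4 * (2 * c)   ≡⟨ *-assoc 4 2 c ⟨
      -- The halves have 3 + i vertices, so `m` is 3; taking `p` as 2 turns Δ + Δ into the 4Δ of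
      -- `long-term`. The sum is at most 21/8 ℓ, rounded up to 3ℓ.
      4 * 2 * c     ≤⟨ geometric N 3 2 ℓ t (λ i → subst (_≤ (3 + i) * ℓ)
                         (sym (lemma₃ (3 ^ i) i Δ (M (2 + i))))
                         (*-monoʳ-≤ (3 + i) (long-term i (bound (2 + i))))) ⟩
      21 * ℓ        ≤⟨ *-monoˡ-≤ ℓ (m≤m+n 21 3) ⟩
      24 * ℓ        ≡⟨ lemma₄ ℓ ⟩
      4 * (6 * ℓ)   ∎)

32≤m²⇒6≤m : ∀ {m} → 32 ≤ m * m → 6 ≤ m
32≤m²⇒6≤m {m} le = ≰⇒> λ m≤5 → <⇒≱ (≤-trans (m≤n+m 26 6) le) (*-mono-≤ m≤5 m≤5)

-- Boundary walks

module _ {A : Set} (f : A → A) where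

  iterate-+ : ∀ x a b → iterate f x (a + b) ≡ iterate f (iterate f x a) b
  iterate-+ x zero    b = refl
  iterate-+ x (suc a) b = iterate-+ (f x) a b

  iterate-period : ∀ {x q} → iterate f x q ≡ x → ∀ r → iterate f x (r * q) ≡ x
  iterate-period         eq zero    = refl
  iterate-period {x} {q} eq (suc r) = trans (iterate-+ x q (r * q))
    (trans (cong (λ y → iterate f y (r * q)) eq) (iterate-period eq r))

  -- x and y both occur at the common position qr + q + r of the orbit of z.
  cycle-injective : ∀ q r {x y z} → f x ≡ z → f y ≡ z → iterate f z q ≡ x → iterate f z r ≡ y → x ≡ y
  cycle-injective q r {z = z} fx fy zx zy =
    trans (sym (at fx zx r)) (trans (cong (iterate f z) (lemma q r)) (at fy zy q))
    where
    at : ∀ {w p} → f w ≡ z → iterate f z p ≡ w → ∀ r → iterate f z (r * (p + 1) + p) ≡ w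
    at {p = p} fw zw r = trans (iterate-+ z (r * (p + 1)) p)
      (trans (cong (λ y → iterate f y p) (iterate-period period r)) zw)
      where
      period = trans (iterate-+ z p 1) (trans (cong f zw) fw)
    lemma : ∀ q r → r * (q + 1) + q ≡ q * (r + 1) + r
    lemma = solve-∀

length-filter-map : ∀ {A B : Set} {P : B → Set} (P? : ∀ y → Dec (P y)) (f : A → B) xs →
                    length (filter P? (map f xs)) ≡ length (filter (P? ∘ f) xs)
length-filter-map P? f []       = refl
length-filter-map P? f (x ∷ xs) with does (P? (f x))
... | true  = cong suc (length-filter-map P? f xs)
... | false = length-filter-map P? f xs

module BoundaryWalks {n : ℕ} (G : PlaneGraph n) where
  open PlaneGraph G

  -- By transitivity the orbit of the common value under `next v` reaches both `u` and `w`, and an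
  -- element of a cycle has only one predecessor in it.
  next-injective : ∀ {v u w} → Adj v u → Adj v w → next v u ≡ next v w → u ≡ w
  next-injective {v} vu vw eq
    with next-cycle (next-adj vu) vu | next-cycle (next-adj vu) vw
  ... | q , to-u | r , to-w = cycle-injective (next v) q r refl (sym eq) to-u to-w

  walk-adj : ∀ {u v} → Adj u v → ∀ i → Adj (walk u v i) (walk u v (suc i))
  walk-adj uv zero    = uv
  walk-adj uv (suc i) = walk-adj (next-adj (symm uv)) i

  -- The walk can be run backwards: `next` is injective around each vertex, so a dart of the walk
  -- determines the one before it.
  walk-injective : ∀ {u v u′ v′} → Adj u v → Adj u′ v′ → ∀ i → walk u v i ≡ walk u′ v′ i →
                   walk u v (suc i) ≡ walk u′ v′ (suc i) → (u , v) ≡ (u′ , v′)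
  walk-injective uv u′v′ zero    refl refl = refl
  walk-injective uv u′v′ (suc i) eq₁  eq₂
    with walk-injective (next-adj (symm uv)) (next-adj (symm u′v′)) i eq₁ eq₂
  ... | eq with cong proj₁ eq
  ... | refl = cong (_, _) (next-injective (symm uv) (symm u′v′) (cong proj₂ eq))

  -- Bare pairs rather than `Dart`s: `Adj` may have several proofs for one pair, which would spoil
  -- the counting.
  darts : List (Fin n × Fin n)
  darts = filter (uncurry adj?) (cartesianProduct (allFin n) (allFin n))

  ∈-darts⁺ : ∀ {u v} → Adj u v → (u , v) ∈ darts
  ∈-darts⁺ uv = ∈-filter⁺ (uncurry adj?) (∈-cartesianProduct⁺ (∈-allFin _) (∈-allFin _)) uv

  ∈-darts⁻ : ∀ {d} → d ∈ darts → uncurry Adj d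
  ∈-darts⁻ d∈ = proj₂ (∈-filter⁻ (uncurry adj?) {xs = cartesianProduct (allFin n) (allFin n)} d∈)

  darts-unique : Unique darts
  darts-unique = Unique.filter⁺ (uncurry adj?)
    (Unique.cartesianProduct⁺ (Unique.allFin⁺ n) (Unique.allFin⁺ n))

  degree≤maxDegree : ∀ v → degree v ≤ maxDegree
  degree≤maxDegree v = All.lookup (xs≤max 0 (map degree (allFin n))) (∈-map⁺ degree (∈-allFin v))

  dartWalk : Fin n × Fin n → ℕ → Fin n
  dartWalk = uncurry walk

  -- By `walk-injective` a walk standing at `v` after `i` steps is determined by its next vertex, a
  -- neighbour of `v`.
  darts-through : ∀ {ds} → Unique ds → (∀ {d} → d ∈ ds → d ∈ darts) → ∀ i v →
                  length (filter (λ d → dartWalk d i Fin.≟ v) ds) ≤ maxDegree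
  darts-through {ds} uniq ds⊆ i v = ≤-trans
    (unique⇒length≤ (λ d → dartWalk d (suc i)) (Unique.filter⁺ P? uniq) into inj)
    (degree≤maxDegree v)
    where
    P? = λ d → dartWalk d i Fin.≟ v
    into : ∀ {d} → d ∈ filter P? ds → dartWalk d (suc i) ∈ filter (adj? v) (allFin n)
    into d∈ with ∈-filter⁻ P? {xs = ds} d∈
    ... | d∈ds , refl = ∈-filter⁺ (adj? v) (∈-allFin _) (walk-adj (∈-darts⁻ (ds⊆ d∈ds)) i)
    inj : ∀ {d e} → d ∈ filter P? ds → e ∈ filter P? ds → dartWalk d (suc i) ≡ dartWalk e (suc i) → d ≡ e
    inj d∈ e∈ eq with ∈-filter⁻ P? {xs = ds} d∈ | ∈-filter⁻ P? {xs = ds} e∈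
    ... | d∈ds , eq₁ | e∈ds , eq₂ =
      walk-injective (∈-darts⁻ (ds⊆ d∈ds)) (∈-darts⁻ (ds⊆ e∈ds)) i (trans eq₁ (sym eq₂)) eq

  -- Facial paths and their halves

  Simple : ℕ → Fin n × Fin n → Set
  Simple m d = ∀ (x y : Fin m) → dartWalk d (toℕ x) ≡ dartWalk d (toℕ y) → x ≡ y

  simple? : ∀ m d → Dec (Simple m d)
  simple? m d = all? λ x → all? λ y → (dartWalk d (toℕ x) Fin.≟ dartWalk d (toℕ y)) →-dec (x Fin.≟ y)

  simple-ℕ : ∀ {m d} → Simple m d → ∀ {a b} → a < m → b < m → dartWalk d a ≡ dartWalk d b → a ≡ b
  simple-ℕ {d = d} simple a<m b<m eq = subst₂ _≡_ (toℕ-fromℕ< a<m) (toℕ-fromℕ< b<m)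
    (cong toℕ (simple (fromℕ< a<m) (fromℕ< b<m)
      (subst₂ (λ a b → dartWalk d a ≡ dartWalk d b) (sym (toℕ-fromℕ< a<m)) (sym (toℕ-fromℕ< b<m)) eq)))

  segment : ∀ {j} → ℕ → Fin n × Fin n → Fin j → Fin n
  segment o d i = dartWalk d (o + toℕ i)

  simpleDarts : ℕ → List (Fin n × Fin n)
  simpleDarts m = filter (simple? m) darts

  edgeHalves : Fin n × Fin n → Halves n 0
  edgeHalves (u , v) = (λ _ → u) , (λ _ → v)

  frontBack backFront : ∀ j → Fin n × Fin n → Halves n j
  frontBack j d = segment 0 d , segment (suc j) d
  backFront j d = segment (suc j) d , segment 0 d

  -- Longer paths are listed once for each choice of the half to be recoloured;
  -- for an edge, its two darts already account for both choices.
  paths : ∀ j → List (Halves n j)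
  paths zero    = map edgeHalves darts
  paths (suc j) = map (frontBack (suc j)) (simpleDarts (2 + j + (2 + j))) ++
                  map (backFront (suc j)) (simpleDarts (2 + j + (2 + j)))

  data PathView : ∀ {j} → Halves n j → Set where
    edge  : ∀ {u v} → Adj u v → PathView {0} ((λ _ → u) , (λ _ → v))
    front : ∀ {j d} → d ∈ simpleDarts (2 + j + (2 + j)) → PathView {suc j} (frontBack (suc j) d)
    back  : ∀ {j d} → d ∈ simpleDarts (2 + j + (2 + j)) → PathView {suc j} (backFront (suc j) d)

  pathView : ∀ {j P} → P ∈ paths j → PathView P
  pathView {zero} P∈ with ∈-map⁻ _ P∈
  ... | (u , v) , d∈ , refl = edge (∈-darts⁻ d∈)
  pathView {suc j} P∈ with ∈-++⁻ (map (frontBack (suc j)) (simpleDarts (2 + j + (2 + j)))) P∈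
  ... | inj₁ P∈′ with ∈-map⁻ _ P∈′
  ...   | d , d∈ , refl = front d∈
  pathView {suc j} P∈ | inj₂ P∈′ with ∈-map⁻ _ P∈′
  ...   | d , d∈ , refl = back d∈

  ∈-paths : ∀ {j P} → PathView {j} P → P ∈ paths j
  ∈-paths (edge uv)      = ∈-map⁺ edgeHalves (∈-darts⁺ uv)
  ∈-paths (front {j} d∈) = ∈-++⁺ˡ (∈-map⁺ (frontBack (suc j)) d∈)
  ∈-paths (back {j} d∈)  = ∈-++⁺ʳ (map (frontBack (suc j)) (simpleDarts (2 + j + (2 + j))))
                             (∈-map⁺ (backFront (suc j)) d∈)

  paths-swapped : ∀ {j own twin} → (own , twin) ∈ paths j → (twin , own) ∈ paths j
  paths-swapped P∈ = ∈-paths (swapView (pathView P∈))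
    where
    swapView : ∀ {j own twin} → PathView {j} (own , twin) → PathView {j} (twin , own)
    swapView (edge uv)  = edge (symm uv)
    swapView (front d∈) = back d∈
    swapView (back d∈)  = front d∈

  module _ {m d} (simple : Simple (m + m) d) where

    private
      front< : ∀ (i : Fin m) → toℕ i < m + m
      front< i = ≤-trans (toℕ<n i) (m≤m+n m m)

      back< : ∀ (i : Fin m) → m + toℕ i < m + m
      back< i = +-monoʳ-< m (toℕ<n i)

    front-injective : Injective _≡_ _≡_ (segment {m} 0 d)
    front-injective {x} {y} eq = toℕ-injective (simple-ℕ simple (front< x) (front< y) eq)

    back-injective : Injective _≡_ _≡_ (segment {m} m d)
    back-injective {x} {y} eq =
      toℕ-injective (+-cancelˡ-≡ m _ _ (simple-ℕ simple (back< x) (back< y) eq))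

    front≢back : ∀ (x y : Fin m) → segment 0 d x ≢ segment m d y
    front≢back x y eq = <⇒≢ (≤-trans (toℕ<n x) (m≤m+n m (toℕ y)))
      (simple-ℕ simple (front< x) (back< y) eq)

  paths-simple : ∀ {j own twin} → (own , twin) ∈ paths j →
                 Injective _≡_ _≡_ own × (∀ i i′ → own i ≢ twin i′)
  paths-simple P∈ = viewed (pathView P∈)
    where
    simpleDart : ∀ {m d} → d ∈ simpleDarts m → Simple m d
    simpleDart d∈ = proj₂ (∈-filter⁻ (simple? _) {xs = darts} d∈)
    viewed : ∀ {j own twin} → PathView {j} (own , twin) → Injective _≡_ _≡_ own × (∀ i i′ → own i ≢ twin i′)
    viewed (edge uv)  = (λ { {zero} {zero} _ → refl }) , λ _ _ eq → irrefl eq uv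
    viewed (front d∈) = front-injective (simpleDart d∈) , front≢back (simpleDart d∈)
    viewed (back d∈)  = back-injective (simpleDart d∈) , λ i i′ → front≢back (simpleDart d∈) i′ i ∘ sym

  -- For an edge, `v` is the tail of the dart. On a longer path, position `a` of the own half is
  -- step `a` or `2 + j + a` of the walk, and `darts-through` applies to either.
  paths-through : ∀ j v a → length (filter (λ P → proj₁ P a Fin.≟ v) (paths j)) ≤ multiplicity maxDegree j
  paths-through zero v a = subst (_≤ maxDegree) (sym (length-filter-map (λ P → proj₁ P a Fin.≟ v) edgeHalves darts))
    (darts-through darts-unique (λ d∈ → d∈) 0 v)
  paths-through (suc j) v a = begin
    length (filter P? (xs ++ ys))                     ≡⟨ cong length (filter-++ P? xs ys) ⟩
    length (filter P? xs ++ filter P? ys)             ≡⟨ length-++ (filter P? xs) ⟩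
    length (filter P? xs) + length (filter P? ys)     ≤⟨ +-mono-≤ (bound 0 (segment (2 + j)))
                                                           (bound (2 + j) (segment 0)) ⟩
    maxDegree + maxDegree                             ∎
    where
    open ≤-Reasoning
    P? = λ (P : Halves n (suc j)) → proj₁ P a Fin.≟ v
    ds = simpleDarts (2 + j + (2 + j))
    xs = map (frontBack (suc j)) ds
    ys = map (backFront (suc j)) ds
    bound : ∀ o (twin : Fin n × Fin n → Fin (2 + j) → Fin n) →
            length (filter P? (map (λ d → segment o d , twin d) ds)) ≤ maxDegree
    bound o twin = subst (_≤ maxDegree) (sym (length-filter-map P? (λ d → segment o d , twin d) ds))
      (darts-through (Unique.filter⁺ (simple? (2 + j + (2 + j))) darts-unique)
        (λ d∈ → proj₁ (∈-filter⁻ (simple? (2 + j + (2 + j))) {xs = darts} d∈)) (o + toℕ a) v)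

-- Decidability of choosability

IsLeast-search : ∀ {P : ℕ → Set} → (∀ m → Dec (P m)) → ∀ b →
                 ∃[ m ] (IsLeast P m × m ≤ b) ⊎ (∀ {m} → m ≤ b → ¬ P m)
IsLeast-search P? zero with P? 0
... | yes p = inj₁ (0 , (p , λ _ _ → z≤n) , z≤n)
... | no ¬p = inj₂ λ { z≤n → ¬p }
IsLeast-search {P} P? (suc b) with IsLeast-search P? b | P? (suc b)
... | inj₁ (m , least , m≤b) | _     = inj₁ (m , least , m≤n⇒m≤1+n m≤b)
... | inj₂ none              | yes p =
  inj₁ (suc b , (p , λ m pm → ≰⇒> λ m≤b → none m≤b pm) , ≤-refl)
... | inj₂ none              | no ¬p = inj₂ above
  where
  above : ∀ {m} → m ≤ suc b → ¬ P m
  above m≤ with m≤n⇒m<n∨m≡n m≤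
  ... | inj₁ (s≤s m≤b) = none m≤b
  ... | inj₂ refl      = ¬p

-- Renaming colours by their positions in a finite list

module _ {A : Set} where

  words : ℕ → List A → List (List A)
  words zero    U = [ [] ]
  words (suc k) U = cartesianProductWith _∷_ U (words k U)

  ∈-words⁺ : ∀ {U} xs → (∀ {x} → x ∈ xs → x ∈ U) → xs ∈ words (length xs) U
  ∈-words⁺ []       _   = here refl
  ∈-words⁺ (x ∷ xs) sub = ∈-cartesianProductWith⁺ _∷_ (sub (here refl)) (∈-words⁺ xs (sub ∘ there))

∈-take⁻ : ∀ {A : Set} k {xs : List A} {x} → x ∈ take k xs → x ∈ xs
∈-take⁻ (suc k) {_ ∷ _} (here eq)  = here eq
∈-take⁻ (suc k) {_ ∷ _} (there x∈) = there (∈-take⁻ k x∈)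

-- The position of the first occurrence; for a colour outside `U` the value is junk, namely
-- `length U`.
code : List ℕ → ℕ → ℕ
code []      x = 0
code (y ∷ U) x with x ≟ y
... | yes _ = 0
... | no  _ = suc (code U x)

decode : List ℕ → ℕ → ℕ
decode []      _       = 0
decode (y ∷ U) zero    = y
decode (y ∷ U) (suc i) = decode U i

code-< : ∀ {U x} → x ∈ U → code U x < length U
code-< {y ∷ U} {x} x∈ with x ≟ y | x∈
... | yes _  | _         = s≤s z≤n
... | no x≢y | here eq   = contradiction eq x≢y
... | no _   | there x∈′ = s≤s (code-< x∈′)

decode-code : ∀ {U x} → x ∈ U → decode U (code U x) ≡ x
decode-code {y ∷ U} {x} x∈ with x ≟ y | x∈
... | yes x≡y | _         = sym x≡y
... | no x≢y  | here eq   = contradiction eq x≢y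
... | no _    | there x∈′ = decode-code x∈′

map-decode-code : ∀ {U} xs → (∀ {x} → x ∈ xs → x ∈ U) → map (decode U) (map (code U) xs) ≡ xs
map-decode-code []       _   = refl
map-decode-code (x ∷ xs) sub = cong₂ _∷_ (decode-code (sub (here refl))) (map-decode-code xs (sub ∘ there))

module Choosability {n : ℕ} (G : PlaneGraph n) where
  open PlaneGraph G
  open BoundaryWalks G

  Square : (Fin n → ℕ) → ℕ → Fin n × Fin n → Set
  Square c j d = Simple (suc j + suc j) d × (∀ (i : Fin (suc j)) → c (segment 0 d i) ≡ c (segment (suc j) d i))

  -- Finitely many conditions suffice: the 2(j + 1) vertices of a path are distinct, which forces j
  -- < n.
  SquareFree : (Fin n → ℕ) → Set
  SquareFree c = ∀ (j : Fin n) → All (λ d → ¬ Square c (toℕ j) d) darts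

  squareFree? : ∀ c → Dec (SquareFree c)
  squareFree? c = all? λ j → All.all? (λ d → ¬? (simple? _ d ×-dec all? λ i → c _ ≟ c _)) darts

  squareFree⇒nonRepetitive : ∀ {c} → SquareFree c → FaciallyNonRepetitive G c
  squareFree⇒nonRepetitive {c} free (suc j) _ p (p-injective , e , p≡) rep =
    All.lookup (subst (λ j → All (λ d → ¬ Square c j d) darts) (toℕ-fromℕ< j<n) (free (fromℕ< j<n)))
      (∈-darts⁺ (Graph.Dart.edge e))
      ( (λ x y eq → p-injective (trans (p≡ x) (trans eq (sym (p≡ y)))))
      , λ i → trans (sym (cong c (trans (p≡ (i ↑ˡ suc j)) (cong (boundaryWalk e) (toℕ-↑ˡ i (suc j))))))
               (trans (rep i) (cong c (trans (p≡ (suc j ↑ʳ i)) (cong (boundaryWalk e) (toℕ-↑ʳ (suc j) i))))))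
    where
    j<n : j < n
    j<n = ≤-trans (m≤m+n (suc j) (suc j)) (injective⇒≤ p-injective)

  nonRepetitive⇒squareFree : ∀ {c} → FaciallyNonRepetitive G c → SquareFree c
  nonRepetitive⇒squareFree {c} nonRep j = All.tabulate λ {d} d∈ (simple , square) →
    nonRep (suc (toℕ j)) (s≤s z≤n) (λ x → dartWalk d (toℕ x))
      ((λ {x} {y} → simple x y) , dart (∈-darts⁻ d∈) , λ _ → refl)
      λ i → trans (cong (c ∘ dartWalk d) (toℕ-↑ˡ i (suc (toℕ j))))
        (trans (square i) (sym (cong (c ∘ dartWalk d) (toℕ-↑ʳ (suc (toℕ j)) i))))

  nonRepetitive? : ∀ c → Dec (FaciallyNonRepetitive G c)
  nonRepetitive? c = map′ (squareFree⇒nonRepetitive {c}) (nonRepetitive⇒squareFree {c}) (squareFree? c)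

  -- A repetition under `d` is one under `c`. Serves for renaming colours and for replacing a
  -- colouring by its table, which agrees with it pointwise.
  nonRepetitive-refine : ∀ {c d} → (∀ {u w} → d u ≡ d w → c u ≡ c w) →
                         FaciallyNonRepetitive G c → FaciallyNonRepetitive G d
  nonRepetitive-refine refine nonRep j 1≤j p facial rep = nonRep j 1≤j p facial (refine ∘ rep)

  Colourable : (Fin n → List ℕ) → Set
  Colourable L = ∃[ c ] ((∀ v → c v ∈ L v) × FaciallyNonRepetitive G c)

  colourable? : ∀ L → Dec (Colourable L)
  colourable? L = map′ to from (Any.any? (λ c → nonRepetitive? (lookup c)) (choices L))
    where
    to : Any (λ c → FaciallyNonRepetitive G (lookup c)) (choices L) → Colourable L
    to found with find found
    ... | c , c∈ , nonRep = lookup c , ∈-choices⁻ L c∈ , nonRep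
    from : Colourable L → Any (λ c → FaciallyNonRepetitive G (lookup c)) (choices L)
    from (c , c∈ , nonRep) = lose {x = tabulate c}
      (∈-choices⁺ L λ v → subst (_∈ L v) (sym (lookup∘tabulate c v)) (c∈ v))
      (nonRepetitive-refine {c} (λ {u} {w} eq →
        trans (sym (lookup∘tabulate c u)) (trans eq (lookup∘tabulate c w))) nonRep)

  Admissible : ℕ → (Fin n → List ℕ) → Set
  Admissible k L = (∀ v → Unique (L v)) × (∀ v → k ≤ length (L v))

  admissible? : ∀ k L → Dec (Admissible k L)
  admissible? k L = all? (λ v → unique? (L v)) ×-dec all? (λ v → k ≤? length (L v))

  smallLists : ℕ → List (Vec (List ℕ) n)
  smallLists k = choices λ _ → words k (upTo (n * k))

  -- Lists are cut to length `k`, so their union `U` has at most n k entries. Positions in `U`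
  -- rename them to lists over `upTo (n * k)`, and a colouring is renamed back.
  module Relabel {k : ℕ} {L : Fin n → List ℕ} (admissible : Admissible k L) where

    L₀ : Fin n → List ℕ
    L₀ v = take k (L v)

    length-L₀ : ∀ v → length (L₀ v) ≡ k
    length-L₀ v = trans (length-take k (L v)) (m≤n⇒m⊓n≡m (proj₂ admissible v))

    U : List ℕ
    U = concatMap L₀ (allFin n)

    L₀⊆U : ∀ {v x} → x ∈ L₀ v → x ∈ U
    L₀⊆U {v} x∈ = ∈-concatMap⁺ L₀ (lose (∈-allFin v) x∈)

    length-U : length U ≤ n * k
    length-U = subst (λ m → length U ≤ m * k) (length-tabulate {n = n} (λ i → i))
      (length-concatMap-≤ L₀ k (allFin n) λ {v} _ → ≤-reflexive (length-L₀ v))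

    L′ : Vec (List ℕ) n
    L′ = tabulate λ v → map (code U) (L₀ v)

    L′≡ : ∀ v → lookup L′ v ≡ map (code U) (L₀ v)
    L′≡ = lookup∘tabulate _

    L′∈small : L′ ∈ smallLists k
    L′∈small = ∈-choices⁺ _ λ v → subst₂ (λ xs m → xs ∈ words m (upTo (n * k))) (sym (L′≡ v))
      (trans (length-map (code U) (L₀ v)) (length-L₀ v))
      (∈-words⁺ (map (code U) (L₀ v)) λ i∈ → case ∈-map⁻ (code U) i∈ of λ
        { (x , x∈ , refl) → ∈-upTo⁺ (≤-trans (code-< (L₀⊆U x∈)) length-U) })

    L′-admissible : Admissible k (lookup L′)
    L′-admissible =
      -- `decode U` maps the renamed list back to `L₀ v`, so a duplicate in it would be one in
      -- `L₀ v`.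
      (λ v → subst Unique (sym (L′≡ v)) (Unique.map⁻ {f = decode U}
        (subst Unique (sym (map-decode-code (L₀ v) L₀⊆U)) (Unique.take⁺ k (proj₁ admissible v))))) ,
      (λ v → ≤-reflexive (sym (trans (cong length (L′≡ v)) (trans (length-map (code U) (L₀ v)) (length-L₀ v)))))

    pullback : Colourable (lookup L′) → Colourable L
    pullback (c , c∈ , nonRep) = decode U ∘ c , decoded∈ , nonRepetitive-refine {c} refine nonRep
      where
      coded : ∀ v → ∃[ x ] (x ∈ L₀ v × c v ≡ code U x)
      coded v = ∈-map⁻ (code U) (subst (c v ∈_) (L′≡ v) (c∈ v))
      decoded : ∀ v → decode U (c v) ∈ L₀ v × code U (decode U (c v)) ≡ c v
      decoded v with coded v
      ... | x , x∈ , eq rewrite eq | decode-code (L₀⊆U x∈) = x∈ , refl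
      decoded∈ : ∀ v → decode U (c v) ∈ L v
      decoded∈ v = ∈-take⁻ k (proj₁ (decoded v))
      refine : ∀ {u w} → decode U (c u) ≡ decode U (c w) → c u ≡ c w
      refine {u} {w} eq = trans (sym (proj₂ (decoded u))) (trans (cong (code U) eq) (proj₂ (decoded w)))

  choosable? : ∀ k → Dec (FaciallyThueChoosable G k)
  choosable? k = map′
    (λ all L uniq k≤ → let open Relabel (uniq , k≤) in pullback (All.lookup all L′∈small L′-admissible))
    (λ choosable → All.tabulate λ {L} _ (uniq , k≤) → choosable (lookup L) uniq k≤)
    -- `words` also produces lists with repeated colours, hence the test of admissibility.
    (All.all? (λ L → admissible? k (lookup L) →-dec colourable? (lookup L)) (smallLists k))

  -- Each square is a listed path with its front half as own half, and its index, below n, falls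
  -- within the range `2 + n` that `budget` dictates.
  valid⇒squareFree : ∀ {L c} → Colourings.Valid (2 + n) paths L ⊤ c → SquareFree (lookup c)
  valid⇒squareFree {L} {c} valid j = All.tabulate (free (toℕ j) (toℕ<n j))
    where
    avoids : ∀ {j} (j<n : j < n) {P} → P ∈ paths j → ¬ Colourings.Repeats (2 + n) paths L ⊤ c P
    avoids j<n = let j<2+n = ≤-trans j<n (m≤n+m n 2) in All.lookup
      (subst (λ j → All (λ P → ¬ Colourings.Repeats (2 + n) paths L ⊤ c P) (paths j)) (toℕ-fromℕ< j<2+n)
        (valid (fromℕ< j<2+n)))
    free : ∀ j → j < n → ∀ {d} → d ∈ darts → ¬ Square (lookup c) j d
    free zero    j<n d∈ (_ , square) =
      avoids j<n (∈-paths (edge (∈-darts⁻ d∈))) λ i → (∈⊤ , ∈⊤) , square zero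
    free (suc j) j<n {d} d∈ (simple , square) =
      avoids j<n (∈-paths (front (∈-filter⁺ (simple? (2 + j + (2 + j))) d∈ simple))) λ i → (∈⊤ , ∈⊤) , square i

  choosable-bound : 2 ≤ maxDegree → FaciallyThueChoosable G ⌈ maxDegree +4√-+3⌉
  choosable-bound 2≤Δ L uniq k≤ = conclude coloured
    where
    s : ℕ
    s = ⌈√ 16 * maxDegree ⌉
    16Δ≤s² : 16 * maxDegree ≤ s * s
    16Δ≤s² = proj₁ (⌈√⌉-isLeast (16 * maxDegree))
    6≤s : 6 ≤ s
    -- From Δ ≥ 2: s² ≥ 16Δ ≥ 32, which exceeds 5².
    6≤s = 32≤m²⇒6≤m (≤-trans (*-monoʳ-≤ 16 2≤Δ) 16Δ≤s²)
    open Colourings (2 + n) paths L using (Valid)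
    coloured : ∃[ c ] ((∀ v → lookup c v ∈ L v) × Valid ⊤ c)
    coloured = Counting.colourable (2 + n) paths L uniq ⌈ maxDegree +4√-+3⌉ k≤ paths-simple paths-swapped
      (multiplicity maxDegree) paths-through s {{>-nonZero (≤-trans (s≤s z≤n) 6≤s)}} (budget {maxDegree} 16Δ≤s² 6≤s n)
    conclude : ∃[ c ] ((∀ v → lookup c v ∈ L v) × Valid ⊤ c) → Colourable L
    conclude (c , c∈ , valid) =
      lookup c , c∈ , squareFree⇒nonRepetitive {lookup c} (valid⇒squareFree {L} {c} valid)

theorem7 : ∀ {n : ℕ} (G : PlaneGraph n) → 2 ≤ PlaneGraph.maxDegree G →
    ∃[ π ] (IsFacialThueChoiceNumber G π × π ≤ ⌈ PlaneGraph.maxDegree G +4√-+3⌉)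
-- Choosability at the bound rules out a fruitless search, so a least value is found below or at it.
theorem7 G 2≤Δ with IsLeast-search (Choosability.choosable? G) ⌈ PlaneGraph.maxDegree G +4√-+3⌉
... | inj₁ found = found
... | inj₂ none  = contradiction (Choosability.choosable-bound G 2≤Δ) (none ≤-refl)
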